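{- Let $X$ be an LPPE and let $\mathcal{A}$ be its PA. Let $i$ be a summand of $X$ such that for all $\boldsymbol{g}\in\boldsymbol{G}$ and $\boldsymbol{d_i}\in\boldsymbol{D_i}$ we have $a_i(\boldsymbol{g},\boldsymbol{d_i})=\tau$ and there exists $\boldsymbol{e_i}\in\boldsymbol{E_i}$ with $f_i(\boldsymbol{g},\boldsymbol{d_i},\boldsymbol{e_i})=1$. Write $\boldsymbol{n_i}(\boldsymbol{g},\boldsymbol{d_i})$ for the unique target state $\boldsymbol{n_i}(\boldsymbol{g},\boldsymbol{d_i},\boldsymbol{e_i})$ with $f_i(\boldsymbol{g},\boldsymbol{d_i},\boldsymbol{e_i})=1$. Suppose that for every summand $j$ of $X$ (including $j=i$) and all $\boldsymbol{g}\in\boldsymbol{G}$, $\boldsymbol{d_i}\in\boldsymbol{D_i}$, $\boldsymbol{d_j}\in\boldsymbol{D_j}$, $\boldsymbol{e_j}\in\boldsymbol{E_j}$ (where for $j=i$ the values $\boldsymbol{d_i}$ and $\boldsymbol{d_j}$ are quantified independently): if $c_i(\boldsymbol{g},\boldsymbol{d_i})\wedge c_j(\boldsymbol{g},\boldsymbol{d_j})$, then either $i=j$ and $\boldsymbol{n_i}(\boldsymbol{g},\boldsymbol{d_i})=\boldsymbol{n_j}(\boldsymbol{g},\boldsymbol{d_j})$, or all of the following hold: (1) $c_j(\boldsymbol{n_i}(\boldsymbol{g},\boldsymbol{d_i}),\boldsymbol{d_j})$ and $c_i(\boldsymbol{n_j}(\boldsymbol{g},\boldsymbol{d_j},\boldsymbol{e_j}),\boldsymbol{d_i})$;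 (2) $a_j(\boldsymbol{g},\boldsymbol{d_j})=a_j(\boldsymbol{n_i}(\boldsymbol{g},\boldsymbol{d_i}),\boldsymbol{d_j})$; (3) $f_j(\boldsymbol{g},\boldsymbol{d_j},\boldsymbol{e_j})=f_j(\boldsymbol{n_i}(\boldsymbol{g},\boldsymbol{d_i}),\boldsymbol{d_j},\boldsymbol{e_j})$; (4) $\boldsymbol{n_j}(\boldsymbol{n_i}(\boldsymbol{g},\boldsymbol{d_i}),\boldsymbol{d_j},\boldsymbol{e_j})=\boldsymbol{n_i}(\boldsymbol{n_j}(\boldsymbol{g},\boldsymbol{d_j},\boldsymbol{e_j}),\boldsymbol{d_i})$. Then the set of transitions of $\mathcal{A}$ generated by summand $i$ is probabilistically confluent.
   Context: Distributions and PAs. $\mathrm{Distr}(S)$ is the set of probability distributions on a countable set $S$; $\mathbb{1}_t$ is the deterministic distribution with $\mathbb{1}_t(t)=1$. For an equivalence relation $R$ on $S$, $\mu\equiv_R\mu'$ means $\mu(C)=\mu'(C)$ for all $C\in S/R$, where $\mu(C)=\sum_{s\in C}\mu(s)$. A probabilistic automaton (PA) is a tuple $\langle S,s^0,L,\Delta\rangle$ with $S$ a countable set of states, $s^0\in S$ initial, $L$ a countable set of actions containing the unobservable action $\tau$, and $\Delta\subseteq S\times L\times\mathrm{Distr}(S)$ a countable transition relation. Write $s\xrightarrow{a}\mu$ for $(s,a,\mu)\in\Delta$. LPPEs. A linear probabilistic process equation (LPPE) $X$ has a vector of global variables $\boldsymbol{g}$ of type $\boldsymbol{G}$ (and an initial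 value) and a finite collection of summands. Summand $i$ has the form $$\sum_{\boldsymbol{d_i}:\boldsymbol{D_i}}c_i(\boldsymbol{g},\boldsymbol{d_i})\Rightarrow a_i(\boldsymbol{g},\boldsymbol{d_i})\ \sum_{\boldsymbol{e_i}:\boldsymbol{E_i}}^{\bullet} f_i(\boldsymbol{g},\boldsymbol{d_i},\boldsymbol{e_i}):X(\boldsymbol{n_i}(\boldsymbol{g},\boldsymbol{d_i},\boldsymbol{e_i})),$$ where $\boldsymbol{D_i}$ and $\boldsymbol{E_i}$ are (countable) types of local and probabilistic variables, $c_i$ is a Boolean condition, $a_i$ gives an action, $f_i(\boldsymbol{g},\boldsymbol{d_i},\cdot)$ is a probability distribution on $\boldsymbol{E_i}$, and $\boldsymbol{n_i}(\boldsymbol{g},\boldsymbol{d_i},\boldsymbol{e_i})\in\boldsymbol{G}$ is the next state. Informally: $\boldsymbol{d_i}$ with $c_i(\boldsymbol{g},\boldsymbol{d_i})$ is chosen nondeterministically, action $a_i(\boldsymbol{g},\boldsymbol{d_i})$ is taken, and $\boldsymbol{e_i}$ is chosen with probability $f_i(\boldsymbol{g},\boldsymbol{d_i},\boldsymbol{e_i})$. Semantics. The PA of $X$ has as states all vectors $\boldsymbol{g}\in\boldsymbol{G}$. Summand $i$ generates the transition $\boldsymbol{g}\xrightarrow{a}\mu$ if there is $\boldsymbol{d_i}\in\boldsymbol{D_i}$ such that $c_i(\boldsymbol{g},\boldsymbol{d_i})$ holds, $a_i(\boldsymbol{g},\boldsymbol{d_i})=a$, and for all $\boldsymbol{e_i}\in\boldsymbol{E_i}$,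 $\mu(\boldsymbol{n_i}(\boldsymbol{g},\boldsymbol{d_i},\boldsymbol{e_i}))=\sum f_i(\boldsymbol{g},\boldsymbol{d_i},\boldsymbol{e_i'})$, the sum ranging over all $\boldsymbol{e_i'}\in\boldsymbol{E_i}$ with $\boldsymbol{n_i}(\boldsymbol{g},\boldsymbol{d_i},\boldsymbol{e_i})=\boldsymbol{n_i}(\boldsymbol{g},\boldsymbol{d_i},\boldsymbol{e_i'})$. The transitions of the PA are exactly those generated by at least one summand. Confluence. Let $c$ be a set of $\tau$-transitions with deterministic distributions. Write $s\to_c t$ if $(s,\tau,\mathbb{1}_t)\in c$; $s\twoheadrightarrow_c t$ if there is a finite (possibly empty) path of $\to_c$-steps from $s$ to $t$. Let $R_c=\{(s,s')\mid\exists u:\ s\twoheadrightarrow_c u\text{ and }s'\twoheadrightarrow_c u\}$. The set $c$ is probabilistically confluent if $R_c$ is an equivalence relation and, for every path $s\twoheadrightarrow_c t$ and all $a\in L$, $\mu\in\mathrm{Distr}(S)$: $s\xrightarrow{a}\mu$ implies [($\exists\nu\in\mathrm{Distr}(S)$: $t\xrightarrow{a}\nu$ and $\mu\equiv_{R_c}\nu$) or ($a=\tau$ and $\mu\equiv_{R_c}\mathbb{1}_{t}$)]. -}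

module Defs where

open import Level using (0ℓ)
open import Data.Bool using (Bool; T)
open import Data.Empty using (⊥-elim)
open import Data.Fin using (Fin; toℕ)
open import Data.Fin.Properties using (toℕ-injective)
open import Data.List using (List; []; _∷_; foldr; map; filter; deduplicate)
open import Data.List.Membership.Propositional using (_∈_)
open import Data.List.Membership.Propositional.Properties
  using (∈-map⁺; ∈-map⁻; ∈-deduplicate⁺; ∈-deduplicate⁻)
open import Data.List.Relation.Unary.All as All using (All; []; _∷_)
import Data.List.Relation.Unary.All.Properties as All
open import Data.List.Relation.Unary.Any using (here; there)
open import Data.List.Relation.Unary.Unique.Propositional using (Unique; []; _∷_)
import Data.List.Relation.Unary.Unique.Propositional.Properties as Unique
import Data.List.Relation.Unary.Unique.DecPropositional.Properties as DecUnique
open import Data.Nat as ℕ using (ℕ; zero; suc)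
import Data.Nat.Properties as ℕ
open import Data.Product using (Σ-syntax; ∃; ∃₂; _×_; _,_; proj₁; proj₂)
open import Data.Rational as ℚ using (ℚ; 0ℚ; 1ℚ)
import Data.Rational.Properties as ℚ
open import Data.Sum using (_⊎_; inj₁; inj₂)
open import Function using (_∘_; _↣_; Injection)
open import Relation.Binary using (Rel; DecidableEquality; IsEquivalence)
open import Relation.Binary.Construct.Closure.ReflexiveTransitive using (Star)
open import Relation.Binary.PropositionalEquality
  using (_≡_; _≢_; refl; sym; trans; cong; subst; module ≡-Reasoning)
open import Relation.Nullary using (¬_; Dec; yes; no; ¬?)
open import Relation.Nullary.Decidable using (via-injection)
open import Relation.Unary using (Pred; U; _⊆_; _≐_)

Countable : Set → Set
Countable A = A ↣ ℕ

countable⇒≟ : ∀ {A} → Countable A → DecidableEquality A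
countable⇒≟ inj = via-injection inj ℕ._≟_

-- The extended non-negative reals [0,∞], as (lower) Dedekind cuts: `cut x q`
-- says that q < x.  The cut containing every rational is ∞; it is kept so that
-- every sum of non-negative terms exists.

record ℝ≥0∞ : Set₁ where
  field
    cut      : Pred ℚ 0ℓ
    negative : ∀ {q} → q ℚ.< 0ℚ → cut q
    downward : ∀ {p q} → p ℚ.< q → cut q → cut p
    open-cut : ∀ {q} → cut q → ∃ λ r → q ℚ.< r × cut r

open ℝ≥0∞ public

infix 4 _≲_ _≃_
infixl 6 _⊕_

_≲_ : ℝ≥0∞ → ℝ≥0∞ → Set
x ≲ y = cut x ⊆ cut y

_≃_ : ℝ≥0∞ → ℝ≥0∞ → Set
x ≃ y = cut x ≐ cut y

≃-sym : ∀ x y → x ≃ y → y ≃ x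
≃-sym _ _ (p , q) = q , p

≃-trans : ∀ x y z → x ≃ y → y ≃ z → x ≃ z
≃-trans _ _ _ (p , q) (p′ , q′) = p′ ∘ p , q ∘ q′

fromℚ : (p : ℚ) → 0ℚ ℚ.≤ p → ℝ≥0∞
fromℚ p 0≤p = record
  { cut      = ℚ._< p
  ; negative = λ q<0 → ℚ.<-≤-trans q<0 0≤p
  ; downward = ℚ.<-trans
  ; open-cut = ℚ.<-dense
  }

0# 1# : ℝ≥0∞
0# = fromℚ 0ℚ ℚ.≤-refl
1# = fromℚ 1ℚ (ℚ.nonNegative⁻¹ 1ℚ)

r+[q-r]≡q : ∀ r q → r ℚ.+ (q ℚ.- r) ≡ q
r+[q-r]≡q r q = begin
  r ℚ.+ (q ℚ.+ ℚ.- r)  ≡⟨ ℚ.+-comm r _ ⟩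
  q ℚ.+ ℚ.- r ℚ.+ r    ≡⟨ ℚ.+-assoc q (ℚ.- r) r ⟩
  q ℚ.+ (ℚ.- r ℚ.+ r)  ≡⟨ cong (q ℚ.+_) (ℚ.+-inverseˡ r) ⟩
  q ℚ.+ 0ℚ             ≡⟨ ℚ.+-identityʳ q ⟩
  q                    ∎
  where open ≡-Reasoning

q<r⇒q-r<0 : ∀ {q r} → q ℚ.< r → q ℚ.- r ℚ.< 0ℚ
q<r⇒q-r<0 {q} {r} q<r =
  subst (q ℚ.- r ℚ.<_) (ℚ.+-inverseʳ r) (ℚ.+-monoˡ-< (ℚ.- r) q<r)

_⊕_ : ℝ≥0∞ → ℝ≥0∞ → ℝ≥0∞
x ⊕ y = record
  { cut      = λ q → ∃₂ λ r s → cut x r × cut y s × q ℚ.≤ r ℚ.+ s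
  ; negative = λ {q} q<0 → let m , q<m , m<0 = ℚ.<-dense q<0 in
      m , q ℚ.- m , negative x m<0 , negative y (q<r⇒q-r<0 q<m) ,
      ℚ.≤-reflexive (sym (r+[q-r]≡q m q))
  ; downward = λ { p<q (r , s , r∈x , s∈y , q≤r+s) →
      r , s , r∈x , s∈y , ℚ.≤-trans (ℚ.<⇒≤ p<q) q≤r+s }
  ; open-cut = λ { (r , s , r∈x , s∈y , q≤r+s) →
      let r′ , r<r′ , r′∈x = open-cut x r∈x in
      r′ ℚ.+ s , ℚ.≤-<-trans q≤r+s (ℚ.+-monoˡ-< s r<r′) ,
      r′ , s , r′∈x , s∈y , ℚ.≤-refl }
  }

-- The Iverson bracket: 1 if P holds, and 0 otherwise.
⟦_⟧ : Set → ℝ≥0∞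
⟦ P ⟧ = record
  { cut      = λ q → q ℚ.< 0ℚ ⊎ (P × q ℚ.< 1ℚ)
  ; negative = inj₁
  ; downward = λ { p<q (inj₁ q<0)       → inj₁ (ℚ.<-trans p<q q<0)
                 ; p<q (inj₂ (x , q<1)) → inj₂ (x , ℚ.<-trans p<q q<1) }
  ; open-cut = λ { (inj₁ q<0)       → let r , q<r , r<0 = ℚ.<-dense q<0
                                      in r , q<r , inj₁ r<0
                 ; (inj₂ (x , q<1)) → let r , q<r , r<1 = ℚ.<-dense q<1
                                      in r , q<r , inj₂ (x , r<1) }
  }

finSum : {A : Set} → (A → ℝ≥0∞) → List A → ℝ≥0∞
finSum h = foldr (λ a x → h a ⊕ x) 0#

-- `∑ P h` is the sum of h(a) over all a ∈ P: the supremum of the sums over the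
-- finite subsets of P.
∑ : {A : Set} → Pred A 0ℓ → (A → ℝ≥0∞) → ℝ≥0∞
∑ P h = record
  { cut      = λ q → ∃ λ as → Unique as × All P as × cut (finSum h as) q
  ; negative = λ q<0 → [] , [] , [] , q<0
  ; downward = λ { p<q (as , u , ps , q∈) → as , u , ps , downward (finSum h as) p<q q∈ }
  ; open-cut = λ { (as , u , ps , q∈) → let r , q<r , r∈ = open-cut (finSum h as) q∈
                                        in r , q<r , as , u , ps , r∈ }
  }

⊕-mono : ∀ x x′ y y′ → x ≲ x′ → y ≲ y′ → x ⊕ y ≲ x′ ⊕ y′
⊕-mono _ _ _ _ f g (r , s , r∈ , s∈ , q≤) = r , s , f r∈ , g s∈ , q≤

⊕-assoc : ∀ x y z → (x ⊕ y) ⊕ z ≃ x ⊕ (y ⊕ z)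
⊕-assoc x y z = to , from
  where
  to : (x ⊕ y) ⊕ z ≲ x ⊕ (y ⊕ z)
  to (rs , t , (r , s , r∈ , s∈ , rs≤) , t∈ , q≤) =
    r , s ℚ.+ t , r∈ , (s , t , s∈ , t∈ , ℚ.≤-refl) ,
    ℚ.≤-trans q≤ (ℚ.≤-trans (ℚ.+-monoˡ-≤ t rs≤) (ℚ.≤-reflexive (ℚ.+-assoc r s t)))
  from : x ⊕ (y ⊕ z) ≲ (x ⊕ y) ⊕ z
  from (r , st , r∈ , (s , t , s∈ , t∈ , st≤) , q≤) =
    r ℚ.+ s , t , (r , s , r∈ , s∈ , ℚ.≤-refl) , t∈ ,
    ℚ.≤-trans q≤ (ℚ.≤-trans (ℚ.+-monoʳ-≤ r st≤) (ℚ.≤-reflexive (sym (ℚ.+-assoc r s t))))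

⊕-comm : ∀ x y → x ⊕ y ≲ y ⊕ x
⊕-comm x y (r , s , r∈ , s∈ , q≤) =
  s , r , s∈ , r∈ , ℚ.≤-trans q≤ (ℚ.≤-reflexive (ℚ.+-comm r s))

⊕-swap : ∀ x y z → x ⊕ (y ⊕ z) ≲ y ⊕ (x ⊕ z)
⊕-swap x y z = proj₁ (⊕-assoc y x z)
             ∘ ⊕-mono (x ⊕ y) (y ⊕ x) z z (⊕-comm x y) (λ z∈ → z∈)
             ∘ proj₂ (⊕-assoc x y z)

⊕-identityʳ : ∀ x → x ⊕ 0# ≃ x
⊕-identityʳ x = to , from
  where
  to : x ⊕ 0# ≲ x
  to (r , s , r∈ , s<0 , q≤) = downward x
    (ℚ.≤-<-trans q≤ (subst (r ℚ.+ s ℚ.<_) (ℚ.+-identityʳ r) (ℚ.+-monoʳ-< r s<0))) r∈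
  from : x ≲ x ⊕ 0#
  from {q} q∈ = let r , q<r , r∈ = open-cut x q∈ in
    r , q ℚ.- r , r∈ , q<r⇒q-r<0 q<r , ℚ.≤-reflexive (sym (r+[q-r]≡q r q))

-- No bound on prob is needed: as the probabilities sum to 1, they lie in [0,1].
record Distr (S : Set) : Set₁ where
  field
    prob  : S → ℝ≥0∞
    total : ∑ U prob ≃ 1#

open Distr public

infix 4 _≈_

_≈_ : {S : Set} → Distr S → Distr S → Set
μ ≈ ν = ∀ s → prob μ s ≃ prob ν s

mass : {S : Set} → Distr S → Pred S 0ℓ → ℝ≥0∞
mass μ C = ∑ C (prob μ)

-- For an equivalence relation R, the classes of R are the sets R s.
infix 4 _≡[_]_

_≡[_]_ : {S : Set} → Distr S → Rel S 0ℓ → Distr S → Set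
μ ≡[ R ] ν = ∀ s → mass μ (R s) ≃ mass ν (R s)

𝟙 : {S : Set} → S → Distr S
𝟙 {S} t = record { prob = δ ; total = total≤1 , 1≤total }
  where
  δ : S → ℝ≥0∞
  δ s = ⟦ s ≡ t ⟧

  finSum≤0 : ∀ ss → All (λ s → t ≢ s) ss → finSum δ ss ≲ 0#
  finSum≤0 []       []        q<0 = q<0
  finSum≤0 (s ∷ ss) (t≢s ∷ n) (p , r , inj₁ p<0        , r∈ , q≤) =
    ℚ.≤-<-trans q≤ (ℚ.+-mono-< p<0 (finSum≤0 ss n r∈))
  finSum≤0 (s ∷ ss) (t≢s ∷ n) (p , r , inj₂ (s≡t , _)  , r∈ , q≤) =
    ⊥-elim (t≢s (sym s≡t))

  finSum≤1 : ∀ ss → Unique ss → finSum δ ss ≲ 1#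
  finSum≤1 []       []      q<0 = negative 1# q<0
  finSum≤1 (s ∷ ss) (_ ∷ u) (p , r , inj₁ p<0          , r∈ , q≤) =
    ℚ.≤-<-trans q≤ (ℚ.+-mono-< p<0 (finSum≤1 ss u r∈))
  finSum≤1 (s ∷ ss) (n ∷ _) (p , r , inj₂ (refl , p<1) , r∈ , q≤) =
    ℚ.≤-<-trans q≤ (ℚ.+-mono-< p<1 (finSum≤0 ss n r∈))

  total≤1 : ∑ U δ ≲ 1#
  total≤1 (ss , u , _ , q∈) = finSum≤1 ss u q∈

  1≤total : 1# ≲ ∑ U δ
  1≤total q<1 =
    t ∷ [] , [] ∷ [] , _ ∷ [] , proj₂ (⊕-identityʳ (δ t)) (inj₂ (refl , q<1))

-- A distribution on S is determined by its values on the image of n : E → S if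
-- these values are those of the push-forward of a distribution on E.
module _ {E S : Set} (_≟_ : DecidableEquality S) (φ : Distr E) (n : E → S) where

  IsPushforward : Distr S → Set
  IsPushforward μ = ∀ e → prob μ (n e) ≃ ∑ (λ e′ → n e ≡ n e′) (prob φ)

  pushforward-resp-≈ : ∀ μ ν → μ ≈ ν → IsPushforward μ → IsPushforward ν
  pushforward-resp-≈ μ ν μ≈ν h e =
    ≃-trans (prob ν (n e)) (prob μ (n e)) (∑ (λ e′ → n e ≡ n e′) (prob φ))
      (≃-sym (prob μ (n e)) (prob ν (n e)) (μ≈ν (n e))) (h e)

  private
    n≟ : ∀ s e → Dec (s ≡ n e)
    n≟ s e = s ≟ n e

    ≢? : ∀ s e → Dec (s ≢ n e)
    ≢? s e = ¬? (n≟ s e)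

  split : ∀ s es → finSum (prob φ) es ≲
    finSum (prob φ) (filter (n≟ s) es) ⊕ finSum (prob φ) (filter (≢? s) es)
  split s []       = proj₂ (⊕-identityʳ 0#)
  split s (e ∷ es) with s ≟ n e
  ... | yes _ = proj₂ (⊕-assoc x a b) ∘ step
    where
    x = prob φ e
    a = finSum (prob φ) (filter (n≟ s) es)
    b = finSum (prob φ) (filter (≢? s) es)
    step = ⊕-mono x x (finSum (prob φ) es) (a ⊕ b) (λ z → z) (split s es)
  ... | no _  = ⊕-swap x a b ∘ step
    where
    x = prob φ e
    a = finSum (prob φ) (filter (n≟ s) es)
    b = finSum (prob φ) (filter (≢? s) es)
    step = ⊕-mono x x (finSum (prob φ) es) (a ⊕ b) (λ z → z) (split s es)

  module _ (μ : Distr S) (h : IsPushforward μ) where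

    fibre : ∀ s es → Unique es → All (λ e → s ≡ n e) es →
            finSum (prob φ) es ≲ prob μ s
    fibre s []       _ _          q<0 = negative (prob μ s) q<0
    fibre s (e ∷ es) u (refl ∷ p) q∈  = proj₂ (h e) (e ∷ es , u , refl ∷ p , q∈)

    group : ∀ ss es → Unique es → All (λ e → n e ∈ ss) es →
            finSum (prob φ) es ≲ finSum (prob μ) ss
    group []       []       _ _        q∈ = q∈
    group []       (_ ∷ _)  _ (() ∷ _)
    group (s ∷ ss) es       u p        q∈ =
      ⊕-mono a (prob μ s) b (finSum (prob μ) ss)
        (fibre s _ (Unique.filter⁺ (n≟ s) u) (All.all-filter (n≟ s) es))
        (group ss _ (Unique.filter⁺ (≢? s) u)
          (All.zipWith drop (All.all-filter (≢? s) es , All.filter⁺ (≢? s) p)))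
        (split s es q∈)
      where
      a = finSum (prob φ) (filter (n≟ s) es)
      b = finSum (prob φ) (filter (≢? s) es)
      drop : ∀ {e} → s ≢ n e × n e ∈ s ∷ ss → n e ∈ ss
      drop (s≢ , here n≡s) = ⊥-elim (s≢ (sym n≡s))
      drop (_  , there i)  = i

    -- A state of positive probability lies in the image of n.
    positive⇒image : ∀ s {q} → 0ℚ ℚ.≤ q → cut (prob μ s) q → ∃ λ e → s ≡ n e
    positive⇒image s {q} 0≤q q∈
      with r , q<r , r∈ ← open-cut (prob μ s) q∈
      with es , u , _ , 1-r∈ ← proj₂ (total φ) {1ℚ ℚ.- r}
             (subst (1ℚ ℚ.- r ℚ.<_) (ℚ.+-identityʳ 1ℚ)
               (ℚ.+-monoʳ-< 1ℚ (ℚ.neg-antimono-< (ℚ.≤-<-trans 0≤q q<r))))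
      with All.all? (≢? s) es
    ... | no ¬p = let e , _ , s≡ = find-not es ¬p in e , s≡
      where
      find-not : ∀ es → ¬ All (λ e → s ≢ n e) es → ∃ λ e → e ∈ es × s ≡ n e
      find-not []       ¬p = ⊥-elim (¬p [])
      find-not (e ∷ es) ¬p with s ≟ n e
      ... | yes s≡ = e , here refl , s≡
      ... | no  s≢ = let e′ , i , s≡ = find-not es (λ p → ¬p (s≢ ∷ p))
                     in e′ , there i , s≡
    ... | yes s∉ = ⊥-elim (ℚ.<-irrefl refl (proj₁ (total μ) {1ℚ}
        ( s ∷ ss , fresh ∷ DecUnique.deduplicate-! _≟_ (map n es) , All.universal-U _
        , r , 1ℚ ℚ.- r , r∈
        , group ss es u (All.tabulate λ i → ∈-deduplicate⁺ _≟_ (∈-map⁺ n i)) 1-r∈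
        , ℚ.≤-reflexive (sym (r+[q-r]≡q r 1ℚ)))))
      where
      ss = deduplicate _≟_ (map n es)
      fresh : All (λ s′ → s ≢ s′) ss
      fresh = All.tabulate λ i s≡ →
        let e , j , s′≡ = ∈-map⁻ n (∈-deduplicate⁻ _≟_ (map n es) i)
        in All.lookup s∉ j (trans s≡ s′≡)

  pushforward-≲ : ∀ μ ν → IsPushforward μ → IsPushforward ν →
                  ∀ s → prob μ s ≲ prob ν s
  pushforward-≲ μ ν h k s {q} q∈ with q ℚ.<? 0ℚ
  ... | yes q<0 = negative (prob ν s) q<0
  ... | no  q≮0 with e , refl ← positive⇒image μ h s (ℚ.≮⇒≥ q≮0) q∈ =
    proj₂ (k e) (proj₁ (h e) q∈)

  pushforward-unique : ∀ μ ν → IsPushforward μ → IsPushforward ν → μ ≈ ν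
  pushforward-unique μ ν h k s = pushforward-≲ μ ν h k s , pushforward-≲ ν μ k h s

-- Subsets of S × L × Distr S.
record Transitions (S L : Set) : Set₁ where
  field
    Trans  : S → L → Distr S → Set
    resp-≈ : ∀ {s α} μ ν → μ ≈ ν → Trans s α μ → Trans s α ν

open Transitions public

-- The code may depend on the proof of Trans, but it determines the triple, where
-- distributions are compared up to _≈_.
record CountableTransitions {S L : Set} (Δ : Transitions S L) : Set₁ where
  field
    code           : ∀ s α μ → Trans Δ s α μ → ℕ
    code-injective : ∀ s s′ α α′ μ μ′ (t : Trans Δ s α μ) (t′ : Trans Δ s′ α′ μ′) →
                     code s α μ t ≡ code s′ α′ μ′ t′ → s ≡ s′ × α ≡ α′ × μ ≈ μ′

record PA : Set₁ where
  field
    S           : Set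
    S-countable : Countable S
    s⁰          : S
    L           : Set
    L-countable : Countable L
    τ           : L
    Δ           : Transitions S L
    Δ-countable : CountableTransitions Δ

module _ (𝒜 : PA) (c : Transitions (PA.S 𝒜) (PA.L 𝒜)) where

  open PA 𝒜

  _⟶_ : Rel S 0ℓ
  s ⟶ t = Trans c s τ (𝟙 t)

  _↠_ : Rel S 0ℓ
  _↠_ = Star _⟶_

  Joinable : Rel S 0ℓ
  Joinable s s′ = ∃ λ u → s ↠ u × s′ ↠ u

  -- The first two fields say that c is a set of τ-transitions of the automaton
  -- with deterministic distributions; confluence is only defined for such sets.
  record ProbabilisticallyConfluent : Set₁ where
    field
      c⊆Δ              : ∀ s α μ → Trans c s α μ → Trans Δ s α μ
      deterministic-τ  : ∀ s α μ → Trans c s α μ → α ≡ τ × ∃ λ t → μ ≈ 𝟙 t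
      isEquivalence    : IsEquivalence Joinable
      confluent        : ∀ s t → s ↠ t → ∀ α μ → Trans Δ s α μ →
                         (∃ λ ν → Trans Δ t α ν × μ ≡[ Joinable ] ν)
                         ⊎ (α ≡ τ × μ ≡[ Joinable ] 𝟙 t)

record LPPE : Set₁ where
  field
    G             : Set
    G-countable   : Countable G
    g⁰            : G
    Act           : Set
    Act-countable : Countable Act
    τ             : Act
    size          : ℕ

  Summand : Set
  Summand = Fin size

  field
    D           : Summand → Set
    D-countable : ∀ i → Countable (D i)
    E           : Summand → Set
    E-countable : ∀ i → Countable (E i)
    c           : ∀ i → G → D i → Bool
    a           : ∀ i → G → D i → Act
    f           : ∀ i → G → D i → Distr (E i)
    n           : ∀ i → G → D i → E i → G

module _ (X : LPPE) where

  open LPPE X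

  private
    _≟_ : DecidableEquality G
    _≟_ = countable⇒≟ G-countable

  Generates : Summand → G → Act → Distr G → Set
  Generates i g α μ = Σ[ d ∈ D i ] T (c i g d) × a i g d ≡ α ×
    (∀ e → prob μ (n i g d e) ≃ ∑ (λ e′ → n i g d e ≡ n i g d e′) (prob (f i g d)))

  generates-resp-≈ : ∀ i {g α} μ ν → μ ≈ ν → Generates i g α μ → Generates i g α ν
  generates-resp-≈ i {g} μ ν μ≈ν (d , cd , ad , h) =
    d , cd , ad , pushforward-resp-≈ _≟_ (f i g d) (n i g d) μ ν μ≈ν h

  generatedBy : Summand → Transitions G Act
  generatedBy i = record { Trans = Generates i ; resp-≈ = generates-resp-≈ i }

  generated : Transitions G Act
  generated = record
    { Trans  = λ g α μ → ∃ λ i → Generates i g α μ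
    ; resp-≈ = λ { μ ν μ≈ν (i , t) → i , generates-resp-≈ i μ ν μ≈ν t }
    }

  private
    pair : ℕ → ℕ → ℕ
    pair zero    k = suc (2 ℕ.* k)
    pair (suc m) k = 2 ℕ.* pair m k

    pair-injective : ∀ m m′ {k k′} → pair m k ≡ pair m′ k′ → m ≡ m′ × k ≡ k′
    pair-injective zero    zero     eq = refl , ℕ.*-cancelˡ-≡ _ _ 2 (ℕ.suc-injective eq)
    pair-injective zero    (suc m′) {k} {k′} eq = ⊥-elim (ℕ.even≢odd (pair m′ k′) k (sym eq))
    pair-injective (suc m) zero     {k} {k′} eq = ⊥-elim (ℕ.even≢odd (pair m k) k′ eq)
    pair-injective (suc m) (suc m′) eq
      with refl , k≡ ← pair-injective m m′ (ℕ.*-cancelˡ-≡ _ _ 2 eq) = refl , k≡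

    codeG : G → ℕ
    codeG = Injection.to G-countable

    codeD : ∀ i → D i → ℕ
    codeD i = Injection.to (D-countable i)

  generated-countable : CountableTransitions generated
  generated-countable = record { code = code ; code-injective = code-injective }
    where
    code : ∀ g α μ → Trans generated g α μ → ℕ
    code g _ _ (i , d , _) = pair (toℕ i) (pair (codeG g) (codeD i d))

    code-injective : ∀ g g′ α α′ μ μ′
      (t : Trans generated g α μ) (t′ : Trans generated g′ α′ μ′) →
      code g α μ t ≡ code g′ α′ μ′ t′ → g ≡ g′ × α ≡ α′ × μ ≈ μ′
    code-injective g g′ _ _ μ μ′ (i , d , _ , ad , h) (i′ , d′ , _ , ad′ , h′) eq
      with eq₁ , eq₂ ← pair-injective (toℕ i) (toℕ i′) eq
      with refl ← toℕ-injective eq₁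
      with eq₃ , eq₄ ← pair-injective (codeG g) (codeG g′) eq₂
      with refl ← Injection.injective G-countable eq₃
      with refl ← Injection.injective (D-countable i) eq₄
      = refl , trans (sym ad) ad′ ,
        pushforward-unique _≟_ (f i g d) (n i g d) μ μ′ h h′

  automaton : PA
  automaton = record
    { S           = G
    ; S-countable = G-countable
    ; s⁰          = g⁰
    ; L           = Act
    ; L-countable = Act-countable
    ; τ           = τ
    ; Δ           = generated
    ; Δ-countable = generated-countable
    }

{-# OPTIONS --safe #-}

-- Two τ-steps of summand i either coincide or close in a square of single steps,
-- so the steps are confluent and joinability is an equivalence R.  If a transition
-- of summand j commutes with the step s → t, the same values of dⱼ give transitions
-- of s and of t whose distributions are push-forwards of equal distributions on Eⱼ,
-- along maps with R-related values.  Since the mass that a push-forward gives to a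
-- class C is the sum over the e sent into C, the two agree on every class of R.

module Submission where

open import Defs
open import Level using (0ℓ)
open import Data.Bool using (T)
open import Data.Empty using (⊥-elim)
import Data.Fin.Properties as Fin
open import Data.List using ([]; _∷_; _++_; map; filter; deduplicate)
open import Data.List.Membership.Propositional using (_∈_)
open import Data.List.Membership.Propositional.Properties
  using (∈-map⁺; ∈-map⁻; ∈-deduplicate⁺; ∈-deduplicate⁻)
open import Data.List.Relation.Unary.All as All using (All; []; _∷_)
import Data.List.Relation.Unary.All.Properties as All
open import Data.List.Relation.Unary.Any using (here; there)
open import Data.List.Relation.Unary.Unique.Propositional using (Unique; []; _∷_)
import Data.List.Relation.Unary.Unique.Propositional.Properties as Unique
import Data.List.Relation.Unary.Unique.DecPropositional.Properties as DecUnique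
open import Data.Product using (Σ; ∃; _×_; _,_; proj₁; proj₂)
open import Data.Rational as ℚ using (0ℚ; 1ℚ)
import Data.Rational.Properties as ℚ
open import Data.Sum using (_⊎_; inj₁; inj₂)
open import Data.Unit using (tt)
open import Function using (_∘_; id; const)
open import Relation.Binary using (Rel; DecidableEquality; IsEquivalence)
open import Relation.Binary.Construct.Closure.ReflexiveTransitive
  using (Star; ε; _◅_; _◅◅_)
open import Relation.Binary.PropositionalEquality
  using (_≡_; _≢_; refl; sym; trans; subst)
open import Relation.Binary.Rewriting using (Confluent)
open import Relation.Nullary using (¬_; Dec; yes; no; ¬?)
open import Relation.Unary using (Pred; U; _⊆_)

-- Sums in [0,∞].

⊕-identityˡ : ∀ x → 0# ⊕ x ≃ x
⊕-identityˡ x =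
  proj₁ (⊕-identityʳ x) ∘ ⊕-comm 0# x , ⊕-comm x 0# ∘ proj₂ (⊕-identityʳ x)

module _ {A : Set} where

  finSum-mono : (h k : A → ℝ≥0∞) → (∀ a → h a ≲ k a) →
                ∀ as → finSum h as ≲ finSum k as
  finSum-mono h k h≲k []       = id
  finSum-mono h k h≲k (a ∷ as) =
    ⊕-mono (h a) (k a) (finSum h as) (finSum k as) (h≲k a) (finSum-mono h k h≲k as)

  finSum-++ : (h : A → ℝ≥0∞) → ∀ as bs →
              finSum h as ⊕ finSum h bs ≲ finSum h (as ++ bs)
  finSum-++ h []       bs = proj₁ (⊕-identityˡ (finSum h bs))
  finSum-++ h (a ∷ as) bs =
    ⊕-mono (h a) (h a) (finSum h as ⊕ finSum h bs) (finSum h (as ++ bs))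
      id (finSum-++ h as bs)
    ∘ proj₁ (⊕-assoc (h a) (finSum h as) (finSum h bs))

  ∑-mono : (P Q : Pred A 0ℓ) (h k : A → ℝ≥0∞) → P ⊆ Q → (∀ a → h a ≲ k a) →
           ∑ P h ≲ ∑ Q k
  ∑-mono P Q h k P⊆Q h≲k (as , u , ps , q∈) =
    as , u , All.map P⊆Q ps , finSum-mono h k h≲k as q∈

  ∑-singleton : (P : Pred A 0ℓ) (h : A → ℝ≥0∞) → ∀ {a} → P a → h a ≲ ∑ P h
  ∑-singleton P h {a} pa q∈ = a ∷ [] , [] ∷ [] , pa ∷ [] , proj₂ (⊕-identityʳ (h a)) q∈

mass-cong : ∀ {S} (μ ν : Distr S) → μ ≈ ν → ∀ C → mass μ C ≃ mass ν C
mass-cong μ ν μ≈ν C =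
    ∑-mono C C (prob μ) (prob ν) id (proj₁ ∘ μ≈ν)
  , ∑-mono C C (prob ν) (prob μ) id (proj₂ ∘ μ≈ν)

-- As 0 < 1, some finite sum exceeds 0, and the empty sum does not.
distr-inhabited : ∀ {E} → Distr E → E
distr-inhabited φ with proj₂ (total φ) {0ℚ} (ℚ.positive⁻¹ 1ℚ)
... | []    , _ , _ , 0<0 = ⊥-elim (ℚ.<-irrefl refl 0<0)
... | e ∷ _ , _           = e

-- Push-forwards and their masses.

module _ {E S : Set} (_≟_ : DecidableEquality S) (φ : Distr E) (n : E → S) where

  fibreSum : S → ℝ≥0∞
  fibreSum s = ∑ (λ e → s ≡ n e) (prob φ)

  -- Each fibre sum is approximated on a finite part of its fibre; fibres over distinct states are
  -- disjoint, so these parts concatenate without repetition.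
  gather : ∀ ss → Unique ss → ∀ {q} → cut (finSum fibreSum ss) q →
           ∃ λ es → Unique es × All (λ e → n e ∈ ss) es × cut (finSum (prob φ) es) q
  gather []       _       q∈ = [] , [] , [] , q∈
  gather (s ∷ ss) (s∉ ∷ u) (r , r′ , (es , v , ps , r∈) , r′∈ , q≤)
    with es′ , v′ , ps′ , r′∈′ ← gather ss u r′∈ =
      es ++ es′
    , Unique.++⁺ v v′ (λ (i , j) → All.lookup s∉ (All.lookup ps′ j) (All.lookup ps i))
    , All.++⁺ (All.map (here ∘ sym) ps) (All.map there ps′)
    , finSum-++ (prob φ) es es′ (r , r′ , r∈ , r′∈′ , q≤)

  -- The members of `es` over `s` form a finite part of the fibre of `s`; the others lie over the
  -- rest of `ss`.
  scatter : ∀ ss es → Unique es → All (λ e → n e ∈ ss) es →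
            finSum (prob φ) es ≲ finSum fibreSum ss
  scatter []       []       _ _        q∈ = q∈
  scatter []       (_ ∷ _)  _ (() ∷ _)
  scatter (s ∷ ss) es       u p        q∈ =
    ⊕-mono a (fibreSum s) b (finSum fibreSum ss)
      (λ r∈ → _ , Unique.filter⁺ s≟ u , All.all-filter s≟ es , r∈)
      (scatter ss _ (Unique.filter⁺ s≢? u)
        (All.zipWith drop (All.all-filter s≢? es , All.filter⁺ s≢? p)))
      (split _≟_ φ n s es q∈)
    where
    s≟ : ∀ e → Dec (s ≡ n e)
    s≟ e = s ≟ n e
    s≢? : ∀ e → Dec (s ≢ n e)
    s≢? e = ¬? (s≟ e)
    a = finSum (prob φ) (filter s≟ es)
    b = finSum (prob φ) (filter s≢? es)
    drop : ∀ {e} → s ≢ n e × n e ∈ s ∷ ss → n e ∈ ss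
    drop (s≢ , here n≡s) = ⊥-elim (s≢ (sym n≡s))
    drop (_  , there i)  = i

  -- Rearrangement of a non-negative sum: the preimage of `C` is the disjoint union of the fibres
  -- over `C`. The case `C = U` shows that the push-forward has total mass 1.
  ∑-fibreSum : (C : Pred S 0ℓ) → ∑ C fibreSum ≃ ∑ (C ∘ n) (prob φ)
  ∑-fibreSum C = to , from
    where
    to : ∑ C fibreSum ≲ ∑ (C ∘ n) (prob φ)
    to (ss , u , ps , q∈) with es , v , is , q∈′ ← gather ss u q∈ =
      es , v , All.map (All.lookup ps) is , q∈′

    from : ∑ (C ∘ n) (prob φ) ≲ ∑ C fibreSum
    from (es , u , ps , q∈) =
        ss , DecUnique.deduplicate-! _≟_ (map n es) , All.tabulate in-C
      , scatter ss es u (All.tabulate (∈-deduplicate⁺ _≟_ ∘ ∈-map⁺ n)) q∈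
      where
      ss = deduplicate _≟_ (map n es)
      in-C : ∀ {s} → s ∈ ss → C s
      in-C i with e , j , refl ← ∈-map⁻ n (∈-deduplicate⁻ _≟_ (map n es) i) = All.lookup ps j

  pushforward : Distr S
  pushforward = record
    { prob  = fibreSum
    ; total = ≃-trans (∑ U fibreSum) (∑ U (prob φ)) 1# (∑-fibreSum U) (total φ)
    }

  pushforward-isPushforward : IsPushforward _≟_ φ n pushforward
  pushforward-isPushforward e = id , id

  -- `IsPushforward` prescribes values on the image of `n` only, but these already determine `μ`, so
  -- `μ` may be replaced by the explicit push-forward.
  mass-pushforward : ∀ μ → IsPushforward _≟_ φ n μ →
                     ∀ C → mass μ C ≃ ∑ (C ∘ n) (prob φ)
  mass-pushforward μ h C =
    ≃-trans (mass μ C) (∑ C fibreSum) (∑ (C ∘ n) (prob φ))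
      (mass-cong μ pushforward
        (pushforward-unique _≟_ φ n μ pushforward h pushforward-isPushforward) C)
      (∑-fibreSum C)

  module _ {e₀ : E} (φe₀≃1 : prob φ e₀ ≃ 1#) where

    -- If a finite sum that avoids `e₀` exceeded some `r` > 0, adding `e₀`, whose probability
    -- exceeds 1 - `r`, would push the total above 1.
    ∑-off-point : (P : Pred E 0ℓ) → ¬ P e₀ → ∑ P (prob φ) ≲ 0#
    ∑-off-point P ¬pe₀ {q} (es , u , ps , q∈) with q ℚ.<? 0ℚ
    ... | yes q<0 = q<0
    ... | no  q≮0
      with r , q<r , r∈ ← open-cut (finSum (prob φ) es) q∈ =
      ⊥-elim (ℚ.<-irrefl refl (proj₁ (total φ)
        ( e₀ ∷ es
        , All.map (λ { p refl → ¬pe₀ p }) ps ∷ u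
        , All.universal-U _
        , 1ℚ ℚ.- r , r
        , proj₂ φe₀≃1 (subst (1ℚ ℚ.- r ℚ.<_) (ℚ.+-identityʳ 1ℚ)
            (ℚ.+-monoʳ-< 1ℚ (ℚ.neg-antimono-< (ℚ.≤-<-trans (ℚ.≮⇒≥ q≮0) q<r))))
        , r∈
        , ℚ.≤-reflexive (trans (sym (r+[q-r]≡q r 1ℚ)) (ℚ.+-comm r _)))))

    𝟙-isPushforward : IsPushforward _≟_ φ n (𝟙 (n e₀))
    𝟙-isPushforward e = to , from
      where
      P : Pred E 0ℓ
      P e′ = n e ≡ n e′

      to : prob (𝟙 (n e₀)) (n e) ≲ ∑ P (prob φ)
      to (inj₁ q<0)       = negative (∑ P (prob φ)) q<0
      to (inj₂ (p , q<1)) = ∑-singleton P (prob φ) p (proj₂ φe₀≃1 q<1)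

      from : ∑ P (prob φ) ≲ prob (𝟙 (n e₀)) (n e)
      from q∈ with n e ≟ n e₀
      ... | yes p = inj₂ (p , proj₁ (total φ) (∑-mono P U (prob φ) (prob φ) _ (λ _ → id) q∈))
      ... | no ¬p = inj₁ (∑-off-point P ¬p q∈)

    -- Both `𝟙 t` and `𝟙 (n e₀)` are the push-forward, so the second is positive at `t`. This
    -- recovers the target of a step from its distribution.
    pushforward-𝟙-injective : ∀ t → IsPushforward _≟_ φ n (𝟙 t) → t ≡ n e₀
    pushforward-𝟙-injective t h
      with proj₁ (pushforward-unique _≟_ φ n (𝟙 t) (𝟙 (n e₀)) h 𝟙-isPushforward t)
             (inj₂ (refl , ℚ.positive⁻¹ 1ℚ))
    ... | inj₁ 0<0       = ⊥-elim (ℚ.<-irrefl refl 0<0)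
    ... | inj₂ (t≡ , _) = t≡

-- Equivalence of distributions modulo R.

module _ {S : Set} {R : Rel S 0ℓ} (R-equiv : IsEquivalence R) where

  private module R = IsEquivalence R-equiv

  ≡[]-trans : ∀ μ ν ρ → μ ≡[ R ] ν → ν ≡[ R ] ρ → μ ≡[ R ] ρ
  ≡[]-trans μ ν ρ p q s = ≃-trans (mass μ (R s)) (mass ν (R s)) (mass ρ (R s)) (p s) (q s)

  module _ (_≟_ : DecidableEquality S) where

    -- A class is closed under `R`, so `m` and `n` send the same elements of `E` into it.
    pushforward-≡[] : ∀ {E} (φ ψ : Distr E) (m n : E → S) → φ ≈ ψ → (∀ e → R (m e) (n e)) →
                      ∀ μ ν → IsPushforward _≟_ φ m μ → IsPushforward _≟_ ψ n ν →
                      μ ≡[ R ] ν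
    pushforward-≡[] φ ψ m n φ≈ψ mRn μ ν h k s =
      ≃-trans (mass μ C) (∑ (C ∘ m) (prob φ)) (mass ν C)
        (mass-pushforward _≟_ φ m μ h C)
        (≃-trans (∑ (C ∘ m) (prob φ)) (∑ (C ∘ n) (prob ψ)) (mass ν C)
          ( ∑-mono (C ∘ m) (C ∘ n) (prob φ) (prob ψ)
              (λ {e} p → R.trans p (mRn e)) (proj₁ ∘ φ≈ψ)
          , ∑-mono (C ∘ n) (C ∘ m) (prob ψ) (prob φ)
              (λ {e} p → R.trans p (R.sym (mRn e))) (proj₂ ∘ φ≈ψ))
          (≃-sym (mass ν C) (∑ (C ∘ n) (prob ψ)) (mass-pushforward _≟_ ψ n ν k C)))
      where
      C = R s

    -- Point distributions are push-forwards from the one-element type along constant maps.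
    𝟙-≡[] : ∀ s t → R s t → 𝟙 s ≡[ R ] 𝟙 t
    𝟙-≡[] s t sRt =
      pushforward-≡[] (𝟙 tt) (𝟙 tt) (const s) (const t) (λ _ → id , id) (const sRt) (𝟙 s) (𝟙 t)
        (𝟙-isPushforward _≟_ (𝟙 tt) (const s) 𝟙tt≃1)
        (𝟙-isPushforward _≟_ (𝟙 tt) (const t) 𝟙tt≃1)
      where
      𝟙tt≃1 : prob (𝟙 tt) tt ≃ 1#
      𝟙tt≃1 = (λ { (inj₁ q<0) → negative 1# q<0 ; (inj₂ (_ , q<1)) → q<1 })
            , (λ q<1 → inj₂ (refl , q<1))

-- Confluence from the diamond property.

module _ {A : Set} {_⟶′_ : Rel A 0ℓ}
  (diamond : ∀ {s t t′} → s ⟶′ t → s ⟶′ t′ → t ≡ t′ ⊎ ∃ λ u → t ⟶′ u × t′ ⟶′ u) where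

  -- Pushing a step across one step of the path leaves at most one step, so induction on the path
  -- needs no termination argument.
  strip : ∀ {s t t′} → s ⟶′ t → Star _⟶′_ s t′ →
          Star _⟶′_ t t′ ⊎ ∃ λ u → Star _⟶′_ t u × t′ ⟶′ u
  strip st ε         = inj₂ (_ , ε , st)
  strip st (sx ◅ xs) with diamond st sx
  ... | inj₁ refl           = inj₁ xs
  ... | inj₂ (u , tu , xu) with strip xu xs
  ...   | inj₁ us             = inj₁ (tu ◅ us)
  ...   | inj₂ (v , us , t′v) = inj₂ (v , tu ◅ us , t′v)

  diamond⇒confluent : Confluent _⟶′_
  diamond⇒confluent ε         ys = _ , ys , ε
  diamond⇒confluent (sx ◅ xs) ys with strip sx ys
  ... | inj₁ zs = diamond⇒confluent xs zs
  ... | inj₂ (u , zs , t′u) with v , ps , qs ← diamond⇒confluent xs zs = v , ps , t′u ◅ qs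

theorem28 : (X : LPPE) → let open LPPE X in
    (i : Summand) →
    (∀ g d → a i g d ≡ τ) →
    (point : ∀ g d → ∃ λ e → prob (f i g d) e ≃ 1#) →
    let nᵢ : G → D i → G
        nᵢ g d = n i g d (proj₁ (point g d))
    in
    (∀ j g (dᵢ : D i) (dⱼ : D j) (eⱼ : E j) →
      T (c i g dᵢ) → T (c j g dⱼ) →
      (Σ (i ≡ j) λ i≡j → nᵢ g dᵢ ≡ nᵢ g (subst D (sym i≡j) dⱼ))
      ⊎ ( (T (c j (nᵢ g dᵢ) dⱼ) × T (c i (n j g dⱼ eⱼ) dᵢ))
        × a j g dⱼ ≡ a j (nᵢ g dᵢ) dⱼ
        × prob (f j g dⱼ) eⱼ ≃ prob (f j (nᵢ g dᵢ) dⱼ) eⱼ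
        × n j (nᵢ g dᵢ) dⱼ eⱼ ≡ nᵢ (n j g dⱼ eⱼ) dᵢ )) →
    ProbabilisticallyConfluent (automaton X) (generatedBy X i)
theorem28 X i a≡τ point commute = record
  { c⊆Δ             = λ s α μ t → i , t
  ; deterministic-τ = deterministic-τ
  ; isEquivalence   = isEquivalence
  ; confluent       = λ _ _ st → confluent st
  }
  where
  open LPPE X

  _≟_ : DecidableEquality G
  _≟_ = countable⇒≟ G-countable

  nᵢ : G → D i → G
  nᵢ g d = n i g d (proj₁ (point g d))

  _⟶ᵢ_ _↠ᵢ_ R : Rel G 0ℓ
  _⟶ᵢ_ = _⟶_ (automaton X) (generatedBy X i)
  _↠ᵢ_ = _↠_ (automaton X) (generatedBy X i)
  R    = Joinable (automaton X) (generatedBy X i)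

  𝟙-push : ∀ s d → IsPushforward _≟_ (f i s d) (n i s d) (𝟙 (nᵢ s d))
  𝟙-push s d = 𝟙-isPushforward _≟_ (f i s d) (n i s d) (proj₂ (point s d))

  pushforward≈𝟙 : ∀ s d μ → IsPushforward _≟_ (f i s d) (n i s d) μ → μ ≈ 𝟙 (nᵢ s d)
  pushforward≈𝟙 s d μ h =
    pushforward-unique _≟_ (f i s d) (n i s d) μ (𝟙 (nᵢ s d)) h (𝟙-push s d)

  step : ∀ {s d} → T (c i s d) → s ⟶ᵢ nᵢ s d
  step {s} {d} cd = d , cd , a≡τ s d , 𝟙-push s d

  step⁻¹ : ∀ {s t} → s ⟶ᵢ t → ∃ λ d → T (c i s d) × t ≡ nᵢ s d
  step⁻¹ {s} {t} (d , cd , _ , h) =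
    d , cd , pushforward-𝟙-injective _≟_ (f i s d) (n i s d) (proj₂ (point s d)) t h

  deterministic-τ : ∀ s α μ → Generates X i s α μ → α ≡ τ × ∃ λ t → μ ≈ 𝟙 t
  deterministic-τ s α μ (d , cd , ad , h) =
    trans (sym ad) (a≡τ s d) , nᵢ s d , pushforward≈𝟙 s d μ h

  diamond : ∀ {s t t′} → s ⟶ᵢ t → s ⟶ᵢ t′ → t ≡ t′ ⊎ ∃ λ u → t ⟶ᵢ u × t′ ⟶ᵢ u
  diamond {s} st st′ with step⁻¹ st | step⁻¹ st′
  ... | d , cd , refl | d′ , cd′ , refl with commute i s d d′ (proj₁ (point s d′)) cd cd′
  ...   | inj₁ (refl , eq) = inj₁ eq
  ...   | inj₂ ((c₁ , c₂) , _ , f≃f , n≡n) =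
    inj₂ (nᵢ t d′ , step c₁ , subst (t′ ⟶ᵢ_) eq (step c₂))
    where
    t = nᵢ s d
    t′ = nᵢ s d′
    e = proj₁ (point s d′)
    -- `point t d′` may pick an element other than `e`. Since `e` also has probability 1 at `t`,
    -- both give the same target.
    f≃1 : prob (f i t d′) e ≃ 1#
    f≃1 = ≃-trans (prob (f i t d′) e) (prob (f i s d′) e) 1#
            (≃-sym (prob (f i s d′) e) (prob (f i t d′) e) f≃f) (proj₂ (point s d′))
    eq : nᵢ t′ d ≡ nᵢ t d′
    eq = trans (sym n≡n) (sym (pushforward-𝟙-injective _≟_ (f i t d′) (n i t d′) f≃1 _
           (𝟙-push t d′)))

  isEquivalence : IsEquivalence R
  isEquivalence = record
    { refl  = _ , ε , ε
    ; sym   = λ (u , p , q) → u , q , p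
    ; trans = λ (u , p , q) (v , p′ , q′) →
        let w , r , r′ = diamond⇒confluent diamond q p′ in w , p ◅◅ r , q′ ◅◅ r′
    }

  ↠⇒R : ∀ {s t} → s ↠ᵢ t → R s t
  ↠⇒R st = _ , st , ε

  Matched : G → Act → Distr G → Set₁
  Matched t α μ = (∃ λ ν → Trans (generated X) t α ν × μ ≡[ R ] ν) ⊎ (α ≡ τ × μ ≡[ R ] 𝟙 t)

  -- The first alternative of commute does not mention eⱼ; deciding it beforehand makes
  -- the choice of alternative uniform in eⱼ.
  same-target? : ∀ j s (d : D i) (dⱼ : D j) →
                 Dec (Σ (i ≡ j) λ i≡j → nᵢ s d ≡ nᵢ s (subst D (sym i≡j) dⱼ))
  same-target? j s d dⱼ with i Fin.≟ j
  ... | no  i≢j  = no (i≢j ∘ proj₁)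
  ... | yes refl with nᵢ s d ≟ nᵢ s dⱼ
  ...   | yes eq = yes (refl , eq)
  ...   | no  ¬eq = no λ { (refl , eq) → ¬eq eq }

  match-step : ∀ {s t} → s ⟶ᵢ t → ∀ α μ → Trans (generated X) s α μ → Matched t α μ
  match-step {s} st α μ (j , dⱼ , cdⱼ , adⱼ , h) with step⁻¹ st
  ... | d , cd , refl with same-target? j s d dⱼ
  -- Here the transition is itself a step to `t`, so `t` matches it by staying put.
  ...   | yes (refl , eq) = inj₂
    ( trans (sym adⱼ) (a≡τ s dⱼ)
    , subst (λ t → μ ≡[ R ] 𝟙 t) (sym eq)
        (λ r → mass-cong μ (𝟙 (nᵢ s dⱼ)) (pushforward≈𝟙 s dⱼ μ h) (R r)))
  ...   | no ¬same = inj₁ (ν , (j , dⱼ , cⱼ , trans (sym a≡a) adⱼ , ν-push) , μ≡ν)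
    where
    t = nᵢ s d
    Commutes : E j → Set
    Commutes e = (T (c j t dⱼ) × T (c i (n j s dⱼ e) d))
               × a j s dⱼ ≡ a j t dⱼ
               × prob (f j s dⱼ) e ≃ prob (f j t dⱼ) e
               × n j t dⱼ e ≡ nᵢ (n j s dⱼ e) d
    commutes : ∀ e → Commutes e
    commutes e with commute j s d dⱼ e cd cdⱼ
    ... | inj₁ same = ⊥-elim (¬same same)
    ... | inj₂ p    = p
    -- The condition and the action of summand `j` do not depend on `e`, so any element of `E j`
    -- yields them.
    e₀ = distr-inhabited (f j s dⱼ)
    cⱼ = proj₁ (proj₁ (commutes e₀))
    a≡a = proj₁ (proj₂ (commutes e₀))
    ν = pushforward _≟_ (f j t dⱼ) (n j t dⱼ)
    ν-push = pushforward-isPushforward _≟_ (f j t dⱼ) (n j t dⱼ)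
    -- The commuting square gives a single step of summand `i` between the two targets.
    targets-R : ∀ e → R (n j s dⱼ e) (n j t dⱼ e)
    targets-R e with (_ , cᵢ) , _ , _ , n≡n ← commutes e =
      subst (R (n j s dⱼ e)) (sym n≡n) (↠⇒R (step cᵢ ◅ ε))
    μ≡ν : μ ≡[ R ] ν
    μ≡ν = pushforward-≡[] isEquivalence _≟_ (f j s dⱼ) (f j t dⱼ) (n j s dⱼ) (n j t dⱼ)
            (λ e → proj₁ (proj₂ (proj₂ (commutes e)))) targets-R μ ν h ν-push

  confluent : ∀ {s t} → s ↠ᵢ t → ∀ α μ → Trans (generated X) s α μ → Matched t α μ
  confluent ε α μ tr = inj₁ (μ , tr , λ _ → id , id)
  confluent {t = t} (_◅_ {j = x} sx xt) α μ tr with match-step sx α μ tr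
  -- Once the transition is absorbed at `x`, it stays absorbed along the remaining path, which keeps
  -- to the class of `x`.
  ... | inj₂ (α≡τ , μ≡𝟙) = inj₂ (α≡τ ,
    ≡[]-trans isEquivalence μ (𝟙 x) (𝟙 t) μ≡𝟙 (𝟙-≡[] isEquivalence _≟_ x t (↠⇒R xt)))
  ... | inj₁ (ν , trν , μ≡ν) with confluent xt α ν trν
  ...   | inj₁ (ρ , trρ , ν≡ρ) = inj₁ (ρ , trρ , ≡[]-trans isEquivalence μ ν ρ μ≡ν ν≡ρ)
  ...   | inj₂ (α≡τ , ν≡𝟙)     = inj₂ (α≡τ , ≡[]-trans isEquivalence μ ν (𝟙 t) μ≡ν ν≡𝟙)
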